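{- Let $\mathscr{A}$ be the set of overpartitions such that (1) only odd parts may be overlined, and (2) the difference between any two parts is at least $4$, and is at least $5$ if the larger of the two parts is overlined or divisible by $4$. For a set $S$ of (possibly overlined) parts, let $\mathscr{A}_S$ be the subset of $\mathscr{A}$ of overpartitions having no part from $S$. Write \[ Q(n_1,n_2,n_3,n_4)=4\tbinom{n_1}{2}+6\tbinom{n_2}{2}+4\tbinom{n_3}{2}+8\tbinom{n_4}{2}+4n_1n_2+4n_1n_3+4n_1n_4+4n_2n_3+4n_2n_4+4n_3n_4, \] and for integers $b_1,b_2,b_3,b_4$ let \[ S(b_1,b_2,b_3,b_4)=\sum_{n_1,n_2,n_3,n_4\ge 0}\frac{x^{n_1+n_2+n_3+n_4}y_1^{n_3}y_2^{n_4}z^{n_2}q^{b_1n_1+b_2n_2+b_3n_3+b_4n_4+Q(n_1,n_2,n_3,n_4)}}{(q^2;q^2)_{n_1}(q^2;q^2)_{n_2}(q^4;q^4)_{n_3}(q^4;q^4)_{n_4}}. \] Writing $W(\lambda)=x^{\sharp(\lambda)}y_1^{\sharp_{2,4}(\lambda)}y_2^{\sharp_{0,4}(\lambda)}z^{\mathsf{O}(\lambda)}q^{|\lambda|}$, we have, as formal power series, \begin{align*} \sum_{\lambda\in\mathscr{A}}W(\lambda)&=S(1,1,2,4),\\ \sum_{\lambda\in\mathscr{A}_{\{\overline{1}\}}}W(\lambda)&=S(1,3,2,4),\\ \sum_{\lambda\in\mathscr{A}_{\{1,\overline{1}\}}}W(\lambda)&=S(3,3,2,4),\\ \sum_{\lambda\in\mathscr{A}_{\{1,\overline{1},2,\overline{3}\}}}W(\lambda)&=S(3,5,6,4).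 \end{align*}
   Context: An overpartition is a partition in which the first occurrence of each distinct part value may be overlined. For an overpartition $\lambda$: $|\lambda|$ is the sum of its parts, $\sharp(\lambda)$ the number of parts, $\sharp_{a,M}(\lambda)$ the number of parts (overlined or not) congruent to $a$ modulo $M$, and $\mathsf{O}(\lambda)$ the number of overlined parts. In $\mathscr{A}_S$, a non-overlined part $1$ and an overlined part $\overline{1}$ are distinct elements of $S$ (e.g. $\mathscr{A}_{\{\overline{1}\}}$ forbids $\overline{1}$ but allows $1$). $(A;q)_n:=\prod_{k=0}^{n-1}(1-Aq^k)$. -}

module Defs where

open import Data.Nat using (ℕ; zero; suc; _+_; _*_; _∸_; _≤_; _<_; _≟_)
open import Data.Nat.DivMod using (_%_)
open import Data.Nat.Divisibility using (_∣?_)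
open import Data.Nat.Combinatorics using (_C_)
open import Data.Bool using (Bool; true; false; _∨_; if_then_else_)
open import Data.Product using (Σ; _×_; _,_; proj₁; proj₂)
open import Data.Sum using (_⊎_)
open import Data.List using (List; []; _∷_; length; filter; map; upTo)
open import Data.Nat.ListAction using (sum)
open import Data.List.Relation.Unary.All using (All)
open import Data.List.Relation.Unary.Linked using (Linked)
open import Data.List.Relation.Unary.AllPairs using (AllPairs)
open import Data.List.Relation.Unary.Unique.Propositional using (Unique)
open import Data.List.Membership.Propositional using (_∈_; _∉_)
open import Relation.Nullary using (does)
open import Relation.Binary.PropositionalEquality using (_≡_)
open import Function.Bundles using (_⇔_)
import Data.Bool as B

HasCount : {A : Set} → (A → Set) → ℕ → Set
HasCount {A} P k =
  Σ (List A) λ L → Unique L × (∀ x → (x ∈ L) ⇔ P x) × length L ≡ k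

-- A (possibly overlined) part: (value , overlined?)
Part : Set
Part = ℕ × Bool

-- An overpartition is listed with parts in weakly decreasing order;
-- among equal values only the first occurrence may be overlined.
-- This gives each overpartition a unique list representation.
ConsecOK : Part → Part → Set
ConsecOK (p , o) (p' , o') = p' < p ⊎ (p' ≡ p × o' ≡ false)

IsOverpartition : List Part → Set
IsOverpartition λs = All (λ x → 1 ≤ proj₁ x) λs × Linked ConsecOK λs

size : List Part → ℕ
size λs = sum (map proj₁ λs)

nparts : List Part → ℕ
nparts = length

nparts-mod4 : ℕ → List Part → ℕ
nparts-mod4 a λs = length (filter (λ x → proj₁ x % 4 ≟ a) λs)

noverlined : List Part → ℕ
noverlined λs = length (filter (λ x → proj₂ x B.≟ true) λs)

gap : Part → ℕ
gap (p , o) = if o ∨ does (4 ∣? p) then 5 else 4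

GapOK : Part → Part → Set
GapOK (p , o) (p' , o') = p' + gap (p , o) ≤ p

InA : List Part → Set
InA λs = IsOverpartition λs
       × All (λ x → proj₂ x ≡ true → proj₁ x % 2 ≡ 1) λs
       × AllPairs GapOK λs

InA-avoid : List Part → List Part → Set
InA-avoid S λs = InA λs × All (λ x → x ∉ S) λs

Series : Set
Series = ℕ → ℕ

_⊛_ : Series → Series → Series
(f ⊛ g) n = sum (map (λ i → f i * g (n ∸ i)) (upTo (suc n)))
infixl 7 _⊛_

one : Series
one 0 = 1
one (suc _) = 0

qpow : ℕ → Series
qpow e n = if does (n ≟ e) then 1 else 0

-- 1/(1 - q^k) = Σ_{i ≥ 0} q^{k i}   (used only for k ≥ 1)
geom : ℕ → Series
geom k n = if does (k ∣? n) then 1 else 0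

invPoch : ℕ → ℕ → Series
invPoch k zero = one
invPoch k (suc m) = invPoch k m ⊛ geom (k * suc m)

Qf : ℕ → ℕ → ℕ → ℕ → ℕ
Qf n₁ n₂ n₃ n₄ =
  4 * (n₁ C 2) + 6 * (n₂ C 2) + 4 * (n₃ C 2) + 8 * (n₄ C 2)
  + 4 * n₁ * n₂ + 4 * n₁ * n₃ + 4 * n₁ * n₄
  + 4 * n₂ * n₃ + 4 * n₂ * n₄ + 4 * n₃ * n₄

-- the q-series multiplying x^{n₁+n₂+n₃+n₄} y₁^{n₃} y₂^{n₄} z^{n₂} in S(b₁,b₂,b₃,b₄)
Sterm : ℕ → ℕ → ℕ → ℕ → ℕ → ℕ → ℕ → ℕ → Series
Sterm b₁ b₂ b₃ b₄ n₁ n₂ n₃ n₄ =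
  qpow (b₁ * n₁ + b₂ * n₂ + b₃ * n₃ + b₄ * n₄ + Qf n₁ n₂ n₃ n₄)
  ⊛ invPoch 2 n₁ ⊛ invPoch 2 n₂ ⊛ invPoch 4 n₃ ⊛ invPoch 4 n₄

-- coefficient of x^a y₁^k₁ y₂^k₂ z^m q^n in S(b₁,b₂,b₃,b₄):
-- the only contributing summands have n₃ = k₁, n₄ = k₂, n₂ = m,
-- n₁ + n₂ + n₃ + n₄ = a.
Scoeff : ℕ → ℕ → ℕ → ℕ → (a k₁ k₂ m n : ℕ) → ℕ
Scoeff b₁ b₂ b₃ b₄ a k₁ k₂ m n =
  sum (map (λ n₁ → if does (n₁ + m + k₁ + k₂ ≟ a)
                     then Sterm b₁ b₂ b₃ b₄ n₁ m k₁ k₂ n else 0)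
           (upTo (suc a)))

GFIdentity : List Part → ℕ → ℕ → ℕ → ℕ → Set
GFIdentity S b₁ b₂ b₃ b₄ =
  (a k₁ k₂ m n : ℕ) →
  HasCount (λ λs → InA-avoid S λs
                  × nparts λs ≡ a
                  × nparts-mod4 2 λs ≡ k₁
                  × nparts-mod4 0 λs ≡ k₂
                  × noverlined λs ≡ m
                  × size λs ≡ n)
           (Scoeff b₁ b₂ b₃ b₄ a k₁ k₂ m n)

{-# OPTIONS --safe #-}
module Submission where

-- Let F_v be the generating function of the members of 𝒜 all of whose parts c satisfy
-- v + gap c ≤ 4 + |c|, i.e. of those that may sit on top of a smaller part of size v - 4.
-- The four avoidance classes are F_0, F_1, F_2, F_3, and F_{v+4}(x) = F_v(x q⁴).  A member
-- counted by F_v but not by F_{v+1} has a smallest part p with v + gap p = 4 + p; removing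
-- it leaves a member counted by F_{p+4}.  With k ≡ 0 mod 4 this reads
--   F_k     = F_{k+1} + x z q^{k+1} F_{k+5},
--   F_{k+1} = F_{k+2} + x q^{k+1} F_{k+5},
--   F_{k+2} = F_{k+3} + x y₁ q^{k+2} F_{k+6} + x z q^{k+3} F_{k+7},
--   F_{k+3} = F_{k+4} + x q^{k+3} F_{k+7} + x y₂ q^{k+4} F_{k+8}.
-- Splitting one inverse Pochhammer symbol by 1/(q;q)_n = 1/(q;q)_{n-1} + qⁿ/(q;q)_n gives the
-- same recurrences for the series S, and they determine every coefficient because a nonempty
-- member counted by F_v has size at least v.

open import Defs
open import Data.Bool using (true; false; if_then_else_)
import Data.Bool as B
open import Data.List using (List; []; _∷_; _++_; [_]; _∷ʳ_; map; filter; length; applyUpTo; InitLast; initLast; _∷ʳ′_)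
open import Data.List.Membership.Propositional using (_∈_; _∉_)
open import Data.List.Membership.Propositional.Properties using (∈-map⁺; ∈-map⁻; ∈-++⁺ˡ; ∈-++⁺ʳ; ∈-++⁻)
open import Data.List.Properties
  using (length-++; length-map; map-++; map-upTo; map-applyUpTo; filter-++; ∷ʳ-injectiveˡ; ∷ʳ-injectiveʳ)
open import Data.List.Relation.Unary.All as All using (All; []; _∷_)
open import Data.List.Relation.Unary.All.Properties using (∷ʳ⁺; ∷ʳ⁻)
open import Data.List.Relation.Unary.AllPairs as AllPairs using (AllPairs; []; _∷_)
import Data.List.Relation.Unary.AllPairs.Properties as AllPairs
open import Data.List.Relation.Unary.Any using (here; there)
open import Data.List.Relation.Unary.Linked.Properties using (AllPairs⇒Linked)
import Data.List.Relation.Unary.Unique.Propositional.Properties as Unique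
open import Data.Nat
open import Data.Nat.Combinatorics using (_C_; nCk+nC[k+1]≡[n+1]C[k+1]; nC1≡n)
open import Data.Nat.DivMod using (_%_; [m+kn]%n≡m%n; m∣n⇒o%n%m≡o%m; m%n<n)
open import Data.Nat.Divisibility using (_∣?_; _∣0; ∣-refl; ∣m+n∣m⇒∣n; ∣m∣n⇒∣m+n; >⇒∤; divides-refl)
open import Data.Nat.ListAction using (sum)
open import Data.Nat.ListAction.Properties using (sum-++)
open import Data.Nat.Properties
open import Data.Nat.Tactic.RingSolver using (solve-∀)
open import Data.Product using (∃; _×_; _,_; proj₁; proj₂)
open import Data.Sum using (_⊎_; inj₁; inj₂; [_,_]′) renaming (map to map-⊎)
open import Function using (_∘_; id)
open import Function.Bundles using (_⇔_; mk⇔; module Equivalence)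
open import Relation.Binary.PropositionalEquality hiding ([_])
open import Relation.Nullary using (Dec; ¬_; yes; no; does; contradiction; _×-dec_)
open import Relation.Nullary.Decidable using (dec-true; dec-false; does-⇔)
open Equivalence using (to; from)

-- Power series

infixl 6 _⊕_
_⊕_ : Series → Series → Series
(f ⊕ g) n = f n + g n

-- Multiplication by q^e. Recursion on both arguments lets the shift laws hold by plain induction,
-- without truncated subtraction.
shift : ℕ → Series → Series
shift zero    f n       = f n
shift (suc e) f zero    = 0
shift (suc e) f (suc n) = shift e f n

shift-cong : ∀ e {f g} → f ≗ g → shift e f ≗ shift e g
shift-cong zero    f≗g n       = f≗g n
shift-cong (suc e) f≗g zero    = refl
shift-cong (suc e) f≗g (suc n) = shift-cong e f≗g n

shift-⊕ : ∀ e f g → shift e (f ⊕ g) ≗ shift e f ⊕ shift e g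
shift-⊕ zero    f g n       = refl
shift-⊕ (suc e) f g zero    = refl
shift-⊕ (suc e) f g (suc n) = shift-⊕ e f g n

shift-shift : ∀ d e f → shift d (shift e f) ≗ shift (d + e) f
shift-shift zero    e f n       = refl
shift-shift (suc d) e f zero    = refl
shift-shift (suc d) e f (suc n) = shift-shift d e f n

shift-+ : ∀ e f n → shift e f (e + n) ≡ f n
shift-+ zero    f n = refl
shift-+ (suc e) f n = shift-+ e f n

shift-< : ∀ {e n} f → n < e → shift e f n ≡ 0
shift-< {suc e} {zero}  f n<e       = refl
shift-< {suc e} {suc n} f (s≤s n<e) = shift-< f n<e

shift-suc : ∀ e f → shift (suc e) f ≗ shift 1 (shift e f)
shift-suc e f zero    = refl
shift-suc e f (suc n) = refl

-- Peels the constant term off the left factor: f = f(0) + q · (`f ∘ suc`). The laws below become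
-- inductions on n in which f is generalised.
⊛-suc : ∀ f g n → (f ⊛ g) (suc n) ≡ f 0 * g (suc n) + ((f ∘ suc) ⊛ g) n
⊛-suc f g n = cong (f 0 * g (suc n) +_) (trans
  (cong sum (map-applyUpTo suc (λ i → f i * g (suc n ∸ i)) (suc n)))
  (sym (cong sum (map-upTo (λ i → f (suc i) * g (n ∸ i)) (suc n)))))

⊛-cong : ∀ {f f′ g g′} → f ≗ f′ → g ≗ g′ → f ⊛ g ≗ f′ ⊛ g′
⊛-cong p r zero = cong₂ (λ a b → a * b + 0) (p 0) (r 0)
⊛-cong {f} {f′} {g} {g′} p r (suc n) = begin
  (f ⊛ g) (suc n)                          ≡⟨ ⊛-suc f g n ⟩
  f 0 * g (suc n) + ((f ∘ suc) ⊛ g) n      ≡⟨ cong₂ _+_ (cong₂ _*_ (p 0) (r (suc n))) (⊛-cong (p ∘ suc) r n) ⟩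
  f′ 0 * g′ (suc n) + ((f′ ∘ suc) ⊛ g′) n  ≡⟨ ⊛-suc f′ g′ n ⟨
  (f′ ⊛ g′) (suc n)                        ∎
  where open ≡-Reasoning

⊛-distribʳ : ∀ h f g → (f ⊕ g) ⊛ h ≗ f ⊛ h ⊕ g ⊛ h
⊛-distribʳ h f g zero = lemma (f 0) (g 0) (h 0)
  where
  lemma : ∀ a b c → (a + b) * c + 0 ≡ a * c + 0 + (b * c + 0)
  lemma = solve-∀
⊛-distribʳ h f g (suc n)
  rewrite ⊛-suc (f ⊕ g) h n | ⊛-suc f h n | ⊛-suc g h n | ⊛-distribʳ h (f ∘ suc) (g ∘ suc) n
  = lemma (f 0) (g 0) (h (suc n)) _ _
  where
  lemma : ∀ a b c d e → (a + b) * c + (d + e) ≡ a * c + d + (b * c + e)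
  lemma = solve-∀

⊛-distribˡ : ∀ f g h → f ⊛ (g ⊕ h) ≗ f ⊛ g ⊕ f ⊛ h
⊛-distribˡ f g h zero = lemma (f 0) (g 0) (h 0)
  where
  lemma : ∀ a b c → a * (b + c) + 0 ≡ a * b + 0 + (a * c + 0)
  lemma = solve-∀
⊛-distribˡ f g h (suc n)
  rewrite ⊛-suc f (g ⊕ h) n | ⊛-suc f g n | ⊛-suc f h n | ⊛-distribˡ (f ∘ suc) g h n
  = lemma (f 0) (g (suc n)) (h (suc n)) _ _
  where
  lemma : ∀ a b c d e → a * (b + c) + (d + e) ≡ a * b + d + (a * c + e)
  lemma = solve-∀

⊛-zeroˡ : ∀ f n → ((λ _ → 0) ⊛ f) n ≡ 0
⊛-zeroˡ f zero    = refl
⊛-zeroˡ f (suc n) = trans (⊛-suc (λ _ → 0) f n) (⊛-zeroˡ f n)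

⊛-identityˡ : ∀ f → one ⊛ f ≗ f
⊛-identityˡ f zero    = trans (+-identityʳ _) (+-identityʳ _)
⊛-identityˡ f (suc n) = begin
  (one ⊛ f) (suc n)                 ≡⟨ ⊛-suc one f n ⟩
  f (suc n) + 0 + ((one ∘ suc) ⊛ f) n  ≡⟨ cong₂ _+_ (+-identityʳ _) (⊛-zeroˡ f n) ⟩
  f (suc n) + 0                     ≡⟨ +-identityʳ _ ⟩
  f (suc n)                         ∎
  where open ≡-Reasoning

⊛-identityʳ : ∀ f → f ⊛ one ≗ f
⊛-identityʳ f zero    = trans (+-identityʳ _) (*-identityʳ _)
⊛-identityʳ f (suc n) = begin
  (f ⊛ one) (suc n)                 ≡⟨ ⊛-suc f one n ⟩
  f 0 * 0 + ((f ∘ suc) ⊛ one) n     ≡⟨ cong₂ _+_ (*-zeroʳ (f 0)) (⊛-identityʳ (f ∘ suc) n) ⟩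
  f (suc n)                         ∎
  where open ≡-Reasoning

shift-⊛ : ∀ e f g → shift e f ⊛ g ≗ shift e (f ⊛ g)
shift-⊛ zero    f g n       = refl
shift-⊛ (suc e) f g zero    = refl
shift-⊛ (suc e) f g (suc n) = trans (⊛-suc (shift (suc e) f) g n) (shift-⊛ e f g n)

⊛-shift₁ : ∀ f g n → (f ⊛ shift 1 g) (suc n) ≡ (f ⊛ g) n
⊛-shift₁ f g zero = trans (⊛-suc f (shift 1 g) 0)
  (cong (λ t → f 0 * g 0 + (t + 0)) (*-zeroʳ (f 1)))
⊛-shift₁ f g (suc n) = begin
  (f ⊛ shift 1 g) (suc (suc n))                        ≡⟨ ⊛-suc f (shift 1 g) (suc n) ⟩
  f 0 * g (suc n) + ((f ∘ suc) ⊛ shift 1 g) (suc n)    ≡⟨ cong (f 0 * g (suc n) +_) (⊛-shift₁ (f ∘ suc) g n) ⟩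
  f 0 * g (suc n) + ((f ∘ suc) ⊛ g) n                  ≡⟨ ⊛-suc f g n ⟨
  (f ⊛ g) (suc n)                                      ∎
  where open ≡-Reasoning

-- `⊛-suc` peels only the left factor, so a power of q is drawn out of the right factor one q at a
-- time.
⊛-shift : ∀ e f g → f ⊛ shift e g ≗ shift e (f ⊛ g)
⊛-shift zero    f g n       = refl
⊛-shift (suc e) f g zero    = cong (_+ 0) (*-zeroʳ (f 0))
⊛-shift (suc e) f g (suc n) = begin
  (f ⊛ shift (suc e) g) (suc n)        ≡⟨ ⊛-cong {f} {f} (λ _ → refl) (shift-suc e g) (suc n) ⟩
  (f ⊛ shift 1 (shift e g)) (suc n)    ≡⟨ ⊛-shift₁ f (shift e g) n ⟩
  (f ⊛ shift e g) n                    ≡⟨ ⊛-shift e f g n ⟩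
  shift e (f ⊛ g) n                    ∎
  where open ≡-Reasoning

qpow-⊛ : ∀ e f → qpow e ⊛ f ≗ shift e f
qpow-⊛ e f n = begin
  (qpow e ⊛ f) n       ≡⟨ ⊛-cong {g = f} (qpow≗ e) (λ _ → refl) n ⟩
  (shift e one ⊛ f) n  ≡⟨ shift-⊛ e one f n ⟩
  shift e (one ⊛ f) n  ≡⟨ shift-cong e (⊛-identityˡ f) n ⟩
  shift e f n          ∎
  where
  open ≡-Reasoning
  qpow≗ : ∀ e → qpow e ≗ shift e one
  qpow≗ zero    zero    = refl
  qpow≗ zero    (suc n) = refl
  qpow≗ (suc e) zero    = refl
  qpow≗ (suc e) (suc n) = qpow≗ e n

-- From 1/(1 - q^k) = 1 + q^k/(1 - q^k): below k only n = 0 is divisible by k, and from k on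
-- divisibility is unchanged by subtracting k. It fails for k = 0, hence the form `suc j`.
geom-suc : ∀ j → let k = suc j in geom k ≗ one ⊕ shift k (geom k)
geom-suc j n with suc j ≤? n
geom-suc j zero    | no _ rewrite dec-true (suc j ∣? 0) (suc j ∣0) = refl
geom-suc j (suc n) | no k≰n
  rewrite dec-false (suc j ∣? suc n) (>⇒∤ (≰⇒> k≰n)) = sym (shift-< (geom (suc j)) (≰⇒> k≰n))
... | yes k≤n with m , refl ← m≤n⇒∃[o]m+o≡n k≤n = begin
  geom k (k + m)          ≡⟨ cong (λ b → if b then 1 else 0) (does-⇔ (mk⇔ (λ d → ∣m+n∣m⇒∣n d ∣-refl) (∣m∣n⇒∣m+n ∣-refl)) (k ∣? k + m) (k ∣? m)) ⟩
  geom k m                ≡⟨ shift-+ k (geom k) m ⟨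
  shift k (geom k) (k + m) ∎
  where
  open ≡-Reasoning
  k = suc j

invPoch-suc : ∀ k m → invPoch (suc k) (suc m) ≗ invPoch (suc k) m ⊕ shift (suc k * suc m) (invPoch (suc k) (suc m))
invPoch-suc k m n = begin
  (P ⊛ geom e) n                         ≡⟨ ⊛-cong {P} (λ _ → refl) (geom-suc (m + k * suc m)) n ⟩
  (P ⊛ (one ⊕ shift e (geom e))) n       ≡⟨ ⊛-distribˡ P one (shift e (geom e)) n ⟩
  (P ⊛ one) n + (P ⊛ shift e (geom e)) n ≡⟨ cong₂ _+_ (⊛-identityʳ P n) (⊛-shift e P (geom e) n) ⟩
  P n + shift e (P ⊛ geom e) n           ∎
  where
  open ≡-Reasoning
  P = invPoch (suc k) m
  e = suc k * suc m

-- The equation f = g + q^e f. It survives multiplication by a series on either side, so splitting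
-- one inverse Pochhammer factor splits the whole product of four.
record _Splits_into_ (e : ℕ) (f g : Series) : Set where
  constructor splits
  field split : f ≗ g ⊕ shift e f

open _Splits_into_

Splits-⊛ʳ : ∀ {e f g} h → e Splits f into g → e Splits f ⊛ h into (g ⊛ h)
Splits-⊛ʳ {e} {f} {g} h (splits s) .split n = begin
  (f ⊛ h) n                        ≡⟨ ⊛-cong {g = h} s (λ _ → refl) n ⟩
  ((g ⊕ shift e f) ⊛ h) n          ≡⟨ ⊛-distribʳ h g (shift e f) n ⟩
  (g ⊛ h) n + (shift e f ⊛ h) n    ≡⟨ cong ((g ⊛ h) n +_) (shift-⊛ e f h n) ⟩
  (g ⊛ h) n + shift e (f ⊛ h) n    ∎
  where open ≡-Reasoning

Splits-⊛ˡ : ∀ {e f g} h → e Splits f into g → e Splits h ⊛ f into (h ⊛ g)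
Splits-⊛ˡ {e} {f} {g} h (splits s) .split n = begin
  (h ⊛ f) n                        ≡⟨ ⊛-cong {h} (λ _ → refl) s n ⟩
  (h ⊛ (g ⊕ shift e f)) n          ≡⟨ ⊛-distribˡ h g (shift e f) n ⟩
  (h ⊛ g) n + (h ⊛ shift e f) n    ≡⟨ cong ((h ⊛ g) n +_) (⊛-shift e h f n) ⟩
  (h ⊛ g) n + shift e (h ⊛ f) n    ∎
  where open ≡-Reasoning

shift-Splits : ∀ {e f g} d → e Splits f into g → shift d f ≗ shift d g ⊕ shift (d + e) f
shift-Splits {e} {f} {g} d (splits s) n = begin
  shift d f n                          ≡⟨ shift-cong d s n ⟩
  shift d (g ⊕ shift e f) n            ≡⟨ shift-⊕ d g (shift e f) n ⟩
  shift d g n + shift d (shift e f) n  ≡⟨ cong (shift d g n +_) (shift-shift d e f n) ⟩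
  shift d g n + shift (d + e) f n      ∎
  where open ≡-Reasoning

-- Splitting the summands of S

invPochs : ℕ → ℕ → ℕ → ℕ → Series
invPochs n₁ n₂ n₃ n₄ = invPoch 2 n₁ ⊛ invPoch 2 n₂ ⊛ invPoch 4 n₃ ⊛ invPoch 4 n₄

exponent : ℕ → ℕ → ℕ → ℕ → ℕ → ℕ → ℕ → ℕ → ℕ
exponent b₁ b₂ b₃ b₄ n₁ n₂ n₃ n₄ = b₁ * n₁ + b₂ * n₂ + b₃ * n₃ + b₄ * n₄ + Qf n₁ n₂ n₃ n₄

-- Sterm with the power of q applied last, so that it can be moved by shift lemmas alone.
Sterm′ : ℕ → ℕ → ℕ → ℕ → ℕ → ℕ → ℕ → ℕ → Series
Sterm′ b₁ b₂ b₃ b₄ n₁ n₂ n₃ n₄ = shift (exponent b₁ b₂ b₃ b₄ n₁ n₂ n₃ n₄) (invPochs n₁ n₂ n₃ n₄)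

Sterm≗Sterm′ : ∀ b₁ b₂ b₃ b₄ n₁ n₂ n₃ n₄ →
               Sterm b₁ b₂ b₃ b₄ n₁ n₂ n₃ n₄ ≗ Sterm′ b₁ b₂ b₃ b₄ n₁ n₂ n₃ n₄
Sterm≗Sterm′ b₁ b₂ b₃ b₄ n₁ n₂ n₃ n₄ = move I₄ (move I₃ (move I₂ (qpow-⊛ e I₁)))
  where
  e = exponent b₁ b₂ b₃ b₄ n₁ n₂ n₃ n₄
  I₁ = invPoch 2 n₁
  I₂ = invPoch 2 n₂
  I₃ = invPoch 4 n₃
  I₄ = invPoch 4 n₄
  move : ∀ {f g} h → f ≗ shift e g → f ⊛ h ≗ shift e (g ⊛ h)
  move {f} {g} h p n = trans (⊛-cong {g = h} p (λ _ → refl) n) (shift-⊛ e g h n)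

atPred : ℕ → (ℕ → ℕ) → ℕ
atPred zero    f = 0
atPred (suc n) f = f n

C2-suc : ∀ n → suc n C 2 ≡ n + n C 2
C2-suc n = trans (sym (nCk+nC[k+1]≡[n+1]C[k+1] n 1)) (cong (_+ n C 2) (nC1≡n n))

module _ (b₁ b₂ b₃ b₄ : ℕ) where

  private
    -- Here `e` is the full exponent of a summand. Lowering the index leaves `q^b` times a summand
    -- of exponent `e₁`; keeping it adds the exponent `d` of the split factor.
    combine : ∀ {d e e₁ e₂ f g} b → d Splits f into g → e ≡ b + e₁ → e + d ≡ e₂ →
              shift e f ≗ shift b (shift e₁ g) ⊕ shift e₂ f
    combine {d} {e₁ = e₁} {f = f} {g} b s refl refl n =
      trans (shift-Splits (b + e₁) s n) (cong (_+ shift (b + e₁ + d) f n) (sym (shift-shift b e₁ g n)))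

    invPoch-Splits : ∀ k m → (suc k * suc m) Splits invPoch (suc k) (suc m) into invPoch (suc k) m
    invPoch-Splits k m .split = invPoch-suc k m

  -- Lowering n₁ changes Q by a linear form with all coefficients 4, which raises every b by 4 (the
  -- substitution x to x q⁴). Keeping n₁ brings the factor q^(2 n₁), which raises b₁ by 2.
  Sterm′-split₁ : ∀ n₁ n₂ n₃ n₄ n →
    Sterm′ b₁ b₂ b₃ b₄ n₁ n₂ n₃ n₄ n
    ≡ atPred n₁ (λ m → shift b₁ (Sterm′ (4 + b₁) (4 + b₂) (4 + b₃) (4 + b₄) m n₂ n₃ n₄) n)
      + Sterm′ (2 + b₁) b₂ b₃ b₄ n₁ n₂ n₃ n₄ n
  -- At index 0 the coefficient b₁ is multiplied by 0, so raising it changes nothing.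
  Sterm′-split₁ zero n₂ n₃ n₄ n rewrite *-zeroʳ b₁ = refl
  Sterm′-split₁ (suc m) n₂ n₃ n₄ = combine b₁
    (Splits-⊛ʳ (invPoch 4 n₄) (Splits-⊛ʳ (invPoch 4 n₃) (Splits-⊛ʳ (invPoch 2 n₂) (invPoch-Splits 1 m))))
    head (tail b₁ b₂ b₃ b₄ m n₂ n₃ n₄ (Qf (suc m) n₂ n₃ n₄))
    where
    head : exponent b₁ b₂ b₃ b₄ (suc m) n₂ n₃ n₄ ≡ b₁ + exponent (4 + b₁) (4 + b₂) (4 + b₃) (4 + b₄) m n₂ n₃ n₄
    head rewrite C2-suc m = expand b₁ b₂ b₃ b₄ m n₂ n₃ n₄ (m C 2) (n₂ C 2) (n₃ C 2) (n₄ C 2)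
      where
      expand : ∀ b₁ b₂ b₃ b₄ m n₂ n₃ n₄ c₁ c₂ c₃ c₄ →
        b₁ * (suc m) + b₂ * n₂ + b₃ * n₃ + b₄ * n₄ + (4 * (m + c₁) + 6 * c₂ + 4 * c₃ + 8 * c₄
        + 4 * (suc m) * n₂ + 4 * (suc m) * n₃ + 4 * (suc m) * n₄ + 4 * n₂ * n₃ + 4 * n₂ * n₄ + 4 * n₃ * n₄)
        ≡ b₁ + ((4 + b₁) * m + (4 + b₂) * n₂ + (4 + b₃) * n₃ + (4 + b₄) * n₄ + (4 * c₁ + 6 * c₂ + 4 * c₃ + 8 * c₄
        + 4 * m * n₂ + 4 * m * n₃ + 4 * m * n₄ + 4 * n₂ * n₃ + 4 * n₂ * n₄ + 4 * n₃ * n₄))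
      expand = solve-∀
    tail : ∀ b₁ b₂ b₃ b₄ m n₂ n₃ n₄ c →
      b₁ * (suc m) + b₂ * n₂ + b₃ * n₃ + b₄ * n₄ + c + 2 * suc m ≡ (2 + b₁) * (suc m) + b₂ * n₂ + b₃ * n₃ + b₄ * n₄ + c
    tail = solve-∀

  -- As for n₁, but the 6 in front of the binomial of n₂ raises b₂ by 6 when n₂ is lowered.
  Sterm′-split₂ : ∀ n₁ n₂ n₃ n₄ n →
    Sterm′ b₁ b₂ b₃ b₄ n₁ n₂ n₃ n₄ n
    ≡ atPred n₂ (λ m → shift b₂ (Sterm′ (4 + b₁) (6 + b₂) (4 + b₃) (4 + b₄) n₁ m n₃ n₄) n)
      + Sterm′ b₁ (2 + b₂) b₃ b₄ n₁ n₂ n₃ n₄ n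
  Sterm′-split₂ n₁ zero n₃ n₄ n rewrite *-zeroʳ b₂ = refl
  Sterm′-split₂ n₁ (suc m) n₃ n₄ = combine b₂
    (Splits-⊛ʳ (invPoch 4 n₄) (Splits-⊛ʳ (invPoch 4 n₃) (Splits-⊛ˡ (invPoch 2 n₁) (invPoch-Splits 1 m))))
    head (tail b₁ b₂ b₃ b₄ n₁ m n₃ n₄ (Qf n₁ (suc m) n₃ n₄))
    where
    head : exponent b₁ b₂ b₃ b₄ n₁ (suc m) n₃ n₄ ≡ b₂ + exponent (4 + b₁) (6 + b₂) (4 + b₃) (4 + b₄) n₁ m n₃ n₄
    head rewrite C2-suc m = expand b₁ b₂ b₃ b₄ n₁ m n₃ n₄ (n₁ C 2) (m C 2) (n₃ C 2) (n₄ C 2)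
      where
      expand : ∀ b₁ b₂ b₃ b₄ n₁ m n₃ n₄ c₁ c₂ c₃ c₄ →
        b₁ * n₁ + b₂ * (suc m) + b₃ * n₃ + b₄ * n₄ + (4 * c₁ + 6 * (m + c₂) + 4 * c₃ + 8 * c₄
        + 4 * n₁ * (suc m) + 4 * n₁ * n₃ + 4 * n₁ * n₄ + 4 * (suc m) * n₃ + 4 * (suc m) * n₄ + 4 * n₃ * n₄)
        ≡ b₂ + ((4 + b₁) * n₁ + (6 + b₂) * m + (4 + b₃) * n₃ + (4 + b₄) * n₄ + (4 * c₁ + 6 * c₂ + 4 * c₃ + 8 * c₄
        + 4 * n₁ * m + 4 * n₁ * n₃ + 4 * n₁ * n₄ + 4 * m * n₃ + 4 * m * n₄ + 4 * n₃ * n₄))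
      expand = solve-∀
    tail : ∀ b₁ b₂ b₃ b₄ n₁ m n₃ n₄ c →
      b₁ * n₁ + b₂ * (suc m) + b₃ * n₃ + b₄ * n₄ + c + 2 * suc m ≡ b₁ * n₁ + (2 + b₂) * (suc m) + b₃ * n₃ + b₄ * n₄ + c
    tail = solve-∀

  -- The base q⁴ of this Pochhammer symbol makes b₃ rise by 4 when n₃ is kept.
  Sterm′-split₃ : ∀ n₁ n₂ n₃ n₄ n →
    Sterm′ b₁ b₂ b₃ b₄ n₁ n₂ n₃ n₄ n
    ≡ atPred n₃ (λ m → shift b₃ (Sterm′ (4 + b₁) (4 + b₂) (4 + b₃) (4 + b₄) n₁ n₂ m n₄) n)
      + Sterm′ b₁ b₂ (4 + b₃) b₄ n₁ n₂ n₃ n₄ n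
  Sterm′-split₃ n₁ n₂ zero n₄ n rewrite *-zeroʳ b₃ = refl
  Sterm′-split₃ n₁ n₂ (suc m) n₄ = combine b₃
    (Splits-⊛ʳ (invPoch 4 n₄) (Splits-⊛ˡ (invPoch 2 n₁ ⊛ invPoch 2 n₂) (invPoch-Splits 3 m)))
    head (tail b₁ b₂ b₃ b₄ n₁ n₂ m n₄ (Qf n₁ n₂ (suc m) n₄))
    where
    head : exponent b₁ b₂ b₃ b₄ n₁ n₂ (suc m) n₄ ≡ b₃ + exponent (4 + b₁) (4 + b₂) (4 + b₃) (4 + b₄) n₁ n₂ m n₄
    head rewrite C2-suc m = expand b₁ b₂ b₃ b₄ n₁ n₂ m n₄ (n₁ C 2) (n₂ C 2) (m C 2) (n₄ C 2)
      where
      expand : ∀ b₁ b₂ b₃ b₄ n₁ n₂ m n₄ c₁ c₂ c₃ c₄ →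
        b₁ * n₁ + b₂ * n₂ + b₃ * (suc m) + b₄ * n₄ + (4 * c₁ + 6 * c₂ + 4 * (m + c₃) + 8 * c₄
        + 4 * n₁ * n₂ + 4 * n₁ * (suc m) + 4 * n₁ * n₄ + 4 * n₂ * (suc m) + 4 * n₂ * n₄ + 4 * (suc m) * n₄)
        ≡ b₃ + ((4 + b₁) * n₁ + (4 + b₂) * n₂ + (4 + b₃) * m + (4 + b₄) * n₄ + (4 * c₁ + 6 * c₂ + 4 * c₃ + 8 * c₄
        + 4 * n₁ * n₂ + 4 * n₁ * m + 4 * n₁ * n₄ + 4 * n₂ * m + 4 * n₂ * n₄ + 4 * m * n₄))
      expand = solve-∀
    tail : ∀ b₁ b₂ b₃ b₄ n₁ n₂ m n₄ c →
      b₁ * n₁ + b₂ * n₂ + b₃ * (suc m) + b₄ * n₄ + c + 4 * suc m ≡ b₁ * n₁ + b₂ * n₂ + (4 + b₃) * (suc m) + b₄ * n₄ + c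
    tail = solve-∀

  -- Again base q⁴; the 8 in front of the binomial of n₄ raises b₄ by 8 when n₄ is lowered.
  Sterm′-split₄ : ∀ n₁ n₂ n₃ n₄ n →
    Sterm′ b₁ b₂ b₃ b₄ n₁ n₂ n₃ n₄ n
    ≡ atPred n₄ (λ m → shift b₄ (Sterm′ (4 + b₁) (4 + b₂) (4 + b₃) (8 + b₄) n₁ n₂ n₃ m) n)
      + Sterm′ b₁ b₂ b₃ (4 + b₄) n₁ n₂ n₃ n₄ n
  Sterm′-split₄ n₁ n₂ n₃ zero n rewrite *-zeroʳ b₄ = refl
  Sterm′-split₄ n₁ n₂ n₃ (suc m) = combine b₄
    (Splits-⊛ˡ (invPoch 2 n₁ ⊛ invPoch 2 n₂ ⊛ invPoch 4 n₃) (invPoch-Splits 3 m))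
    head (tail b₁ b₂ b₃ b₄ n₁ n₂ n₃ m (Qf n₁ n₂ n₃ (suc m)))
    where
    head : exponent b₁ b₂ b₃ b₄ n₁ n₂ n₃ (suc m) ≡ b₄ + exponent (4 + b₁) (4 + b₂) (4 + b₃) (8 + b₄) n₁ n₂ n₃ m
    head rewrite C2-suc m = expand b₁ b₂ b₃ b₄ n₁ n₂ n₃ m (n₁ C 2) (n₂ C 2) (n₃ C 2) (m C 2)
      where
      expand : ∀ b₁ b₂ b₃ b₄ n₁ n₂ n₃ m c₁ c₂ c₃ c₄ →
        b₁ * n₁ + b₂ * n₂ + b₃ * n₃ + b₄ * (suc m) + (4 * c₁ + 6 * c₂ + 4 * c₃ + 8 * (m + c₄)
        + 4 * n₁ * n₂ + 4 * n₁ * n₃ + 4 * n₁ * (suc m) + 4 * n₂ * n₃ + 4 * n₂ * (suc m) + 4 * n₃ * (suc m))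
        ≡ b₄ + ((4 + b₁) * n₁ + (4 + b₂) * n₂ + (4 + b₃) * n₃ + (8 + b₄) * m + (4 * c₁ + 6 * c₂ + 4 * c₃ + 8 * c₄
        + 4 * n₁ * n₂ + 4 * n₁ * n₃ + 4 * n₁ * m + 4 * n₂ * n₃ + 4 * n₂ * m + 4 * n₃ * m))
      expand = solve-∀
    tail : ∀ b₁ b₂ b₃ b₄ n₁ n₂ n₃ m c →
      b₁ * n₁ + b₂ * n₂ + b₃ * n₃ + b₄ * (suc m) + c + 4 * suc m ≡ b₁ * n₁ + b₂ * n₂ + b₃ * n₃ + (4 + b₄) * (suc m) + c
    tail = solve-∀

-- Counting lists

module _ {A : Set} where

  HasCount-⇔ : ∀ {P Q : A → Set} {k} → (∀ x → P x ⇔ Q x) → HasCount P k → HasCount Q k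
  HasCount-⇔ P⇔Q (L , L! , L⇔P , len) =
    L , L! , (λ x → mk⇔ (to (P⇔Q x) ∘ to (L⇔P x)) (from (L⇔P x) ∘ from (P⇔Q x))) , len

  HasCount-∅ : ∀ {P : A → Set} → (∀ x → ¬ P x) → HasCount P 0
  HasCount-∅ ¬P = [] , [] , (λ x → mk⇔ (λ ()) (λ p → contradiction p (¬P x))) , refl

  HasCount-singleton : ∀ {P : A → Set} a → (∀ x → x ≡ a ⇔ P x) → HasCount P 1
  HasCount-singleton a a⇔P =
    [ a ] , [] ∷ [] , (λ x → mk⇔ (λ { (here x≡a) → to (a⇔P x) x≡a ; (there ()) }) (here ∘ from (a⇔P x))) , refl

  HasCount-⊎ : ∀ {P Q : A → Set} {j k} → (∀ x → P x → ¬ Q x) →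
               HasCount P j → HasCount Q k → HasCount (λ x → P x ⊎ Q x) (j + k)
  HasCount-⊎ disj (L , L! , L⇔P , refl) (M , M! , M⇔Q , refl) =
    L ++ M ,
    Unique.++⁺ L! M! (λ { (x∈L , x∈M) → disj _ (to (L⇔P _) x∈L) (to (M⇔Q _) x∈M) }) ,
    (λ x → mk⇔ (λ x∈ → map-⊎ (to (L⇔P x)) (to (M⇔Q x)) (∈-++⁻ L x∈))
               (λ { (inj₁ p) → ∈-++⁺ˡ (from (L⇔P x) p) ; (inj₂ q) → ∈-++⁺ʳ L (from (M⇔Q x) q) })) ,
    length-++ L

  HasCount-image : ∀ {B : Set} {P : A → Set} {k} (f : A → B) → (∀ {x y} → f x ≡ f y → x ≡ y) →
                   HasCount P k → HasCount (λ y → ∃ λ x → y ≡ f x × P x) k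
  HasCount-image f inj (L , L! , L⇔P , len) =
    map f L , Unique.map⁺ inj L! ,
    (λ y → mk⇔ (λ y∈ → let x , x∈L , y≡ = ∈-map⁻ f y∈ in x , y≡ , to (L⇔P x) x∈L)
               (λ { (x , refl , p) → ∈-map⁺ f (from (L⇔P x) p) })) ,
    trans (length-map f L) len

AllPairs-∷ʳ⁻ : ∀ {A : Set} {R : A → A → Set} xs {y} →
               AllPairs R (xs ∷ʳ y) → AllPairs R xs × All (λ x → R x y) xs
AllPairs-∷ʳ⁻ []       _          = [] , []
AllPairs-∷ʳ⁻ (x ∷ xs) (rs ∷ rss) =
  let rs′ , r = ∷ʳ⁻ rs ; rss′ , rs″ = AllPairs-∷ʳ⁻ xs rss in rs′ ∷ rss′ , r ∷ rs″

-- Overpartitions without small parts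

-- The parts that may precede a smaller part of size v - 4 in a member of 𝒜.
Admissible : ℕ → Part → Set
Admissible v c = (proj₂ c ≡ true → proj₁ c % 2 ≡ 1) × v + gap c ≤ 4 + proj₁ c

Good : ℕ → List Part → Set
Good v l = All (Admissible v) l × AllPairs GapOK l

Admissible-anti : ∀ {v w c} → v ≤ w → Admissible w c → Admissible v c
Admissible-anti v≤w (odd , le) = odd , ≤-trans (+-monoˡ-≤ _ v≤w) le

4≤gap : ∀ c → 4 ≤ gap c
4≤gap (p , true)  = n≤1+n 4
4≤gap (p , false) with p % 4
... | zero  = n≤1+n 4
... | suc _ = ≤-refl

-- Every gap is at least 4. This is the source of the lower bound v on the size of a nonempty
-- member.
Admissible⇒≤ : ∀ {v} c → Admissible v c → v ≤ proj₁ c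
Admissible⇒≤ {v} c (_ , le) = +-cancelʳ-≤ 4 v _
  (≤-trans (+-monoʳ-≤ v (4≤gap c)) (≤-trans le (≤-reflexive (+-comm 4 _))))

-- `GapOK x c` is the inequality of `Admissible (4 + proj₁ c) x` with 4 taken off both sides.
Good-∷ʳ⁻ : ∀ {v} l {c} → Good v (l ∷ʳ c) → Admissible v c × Good (4 + proj₁ c) l
Good-∷ʳ⁻ l (adm , gaps) =
  let adm′ , adm-c = ∷ʳ⁻ adm ; gaps′ , gap-c = AllPairs-∷ʳ⁻ l gaps in
  adm-c , All.zipWith (λ { ((odd , _) , g) → odd , +-monoʳ-≤ 4 g }) (adm′ , gap-c) , gaps′

-- Since v ≤ |c| ≤ 4 + |c|, the larger parts are admissible for v as soon as they may precede c.
Good-∷ʳ⁺ : ∀ {v} l {c} → Admissible v c → Good (4 + proj₁ c) l → Good v (l ∷ʳ c)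
Good-∷ʳ⁺ {v} l {c} adm-c (adm , gaps) =
  ∷ʳ⁺ (All.map (Admissible-anti (≤-trans (Admissible⇒≤ c adm-c) (m≤n+m _ 4))) adm) adm-c ,
  AllPairs.++⁺ gaps ([] ∷ []) (All.map (λ { (_ , le) → +-cancelˡ-≤ 4 _ _ le ∷ [] }) adm)

-- The parts admissible for v but not for 1 + v.
data Tight (v : ℕ) : Part → Set where
  overlined    : suc v % 2 ≡ 1 → Tight v (suc v , true)
  multipleOf4  : suc v % 4 ≡ 0 → Tight v (suc v , false)
  notMultipleOf4 : v % 4 ≢ 0 → Tight v (v , false)

gap-multipleOf4 : ∀ {p} → p % 4 ≡ 0 → gap (p , false) ≡ 5
gap-multipleOf4 {p} eq with p % 4
gap-multipleOf4 refl | .0 = refl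

gap-notMultipleOf4 : ∀ {p} → p % 4 ≢ 0 → gap (p , false) ≡ 4
gap-notMultipleOf4 {p} neq with p % 4
... | zero  = contradiction refl neq
... | suc _ = refl

-- Equality determines the value from the gap: gap 5 forces v + 1, gap 4 forces v.
Admissible⇒Tight : ∀ {v} c → Admissible v c → v + gap c ≡ 4 + proj₁ c → Tight v c
Admissible⇒Tight {v} (p , true) (odd , _) eq
  with refl ← +-cancelʳ-≡ 4 (suc v) p (trans (sym (+-suc v 4)) (trans eq (+-comm 4 p))) = overlined (odd refl)
Admissible⇒Tight {v} (p , false) _ eq with p % 4 ≟ 0
... | yes d with refl ← +-cancelʳ-≡ 4 (suc v) p (trans (sym (+-suc v 4))
        (trans (cong (v +_) (sym (gap-multipleOf4 {p} d))) (trans eq (+-comm 4 p)))) = multipleOf4 d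
... | no d with refl ← +-cancelʳ-≡ 4 v p
        (trans (cong (v +_) (sym (gap-notMultipleOf4 {p} d))) (trans eq (+-comm 4 p))) = notMultipleOf4 d

Tight⇒≡ : ∀ {v c} → Tight v c → v + gap c ≡ 4 + proj₁ c
Tight⇒≡ {v} (overlined _)      = +-comm v 5
Tight⇒≡ {v} (multipleOf4 d)    = trans (cong (v +_) (gap-multipleOf4 {suc v} d)) (+-comm v 5)
Tight⇒≡ {v} (notMultipleOf4 d) = trans (cong (v +_) (gap-notMultipleOf4 {v} d)) (+-comm v 4)

Tight⇒Admissible : ∀ {v c} → Tight v c → Admissible v c
Tight⇒Admissible t@(overlined odd)    = (λ _ → odd) , ≤-reflexive (Tight⇒≡ t)
Tight⇒Admissible t@(multipleOf4 _)    = (λ ()) , ≤-reflexive (Tight⇒≡ t)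
Tight⇒Admissible t@(notMultipleOf4 _) = (λ ()) , ≤-reflexive (Tight⇒≡ t)

-- Statistics and removal of the smallest part

Stats : Set
Stats = (ℕ × ℕ × ℕ × ℕ) × ℕ

isPlain? : (c : Part) → _
isPlain? c = (proj₁ c % 2 ≟ 1) ×-dec (proj₂ c B.≟ false)

nplain : List Part → ℕ
nplain l = length (filter isPlain? l)

-- The summation indices (n₁, n₂, n₃, n₄) of S together with the exponent of q. Counting the
-- non-overlined odd parts instead of all parts makes each part of a member raise exactly one index.
stats : List Part → Stats
stats l = (nplain l , noverlined l , nparts-mod4 2 l , nparts-mod4 0 l) , size l

infixl 6 _⊞_
_⊞_ : Stats → Stats → Stats
((a₁ , a₂ , a₃ , a₄) , m) ⊞ ((b₁ , b₂ , b₃ , b₄) , n) =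
  (a₁ + b₁ , a₂ + b₂ , a₃ + b₃ , a₄ + b₄) , m + n

length-filter-++ : ∀ {A : Set} {P : A → Set} (P? : ∀ x → Dec (P x)) xs ys →
  length (filter P? (xs ++ ys)) ≡ length (filter P? xs) + length (filter P? ys)
length-filter-++ P? xs ys = trans (cong length (filter-++ P? xs ys)) (length-++ (filter P? xs))

stats-∷ʳ : ∀ l c → stats (l ∷ʳ c) ≡ stats [ c ] ⊞ stats l
stats-∷ʳ l c = cong₂ _,_
  (cong₂ _,_ (filtered isPlain?)
    (cong₂ _,_ (filtered (λ x → proj₂ x B.≟ true))
      (cong₂ _,_ (filtered (λ x → proj₁ x % 4 ≟ 2)) (filtered (λ x → proj₁ x % 4 ≟ 0)))))
  (trans (cong sum (map-++ proj₁ l [ c ])) (trans (sum-++ (map proj₁ l) _) (+-comm (size l) _)))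
  where
  filtered : ∀ {P : Part → Set} (P? : ∀ x → Dec (P x)) →
             length (filter P? (l ∷ʳ c)) ≡ length (filter P? [ c ]) + length (filter P? l)
  filtered P? = trans (length-filter-++ P? l [ c ]) (+-comm (length (filter P? l)) _)

Member : ℕ → Stats → List Part → Set
Member v s l = Good v l × stats l ≡ s

EndsIn : Part → Stats → List Part → Set
EndsIn c s l = ∃ λ l′ → l ≡ l′ ∷ʳ c × Good (4 + proj₁ c) l′ × stats [ c ] ⊞ stats l′ ≡ s

-- If the smallest part satisfies the inequality for v strictly, it is admissible for 1 + v, and by
-- `Good-∷ʳ⁺` the whole list is good for 1 + v. Otherwise equality holds and the part is tight. The
-- empty list falls on the `Member (suc v)` side.
Member-step : ∀ v s l → (∃ (λ c → Tight v c × EndsIn c s l) ⊎ Member (suc v) s l) ⇔ Member v s l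
Member-step v s l = mk⇔ join (λ (good , eq) → fork l (initLast l) good eq)
  where
  join : (∃ λ c → Tight v c × EndsIn c s l) ⊎ Member (suc v) s l → Member v s l
  join (inj₁ (c , tight , l′ , refl , good , eq)) =
    Good-∷ʳ⁺ l′ (Tight⇒Admissible tight) good , trans (stats-∷ʳ l′ c) eq
  join (inj₂ ((adm , gaps) , eq)) = (All.map (Admissible-anti (n≤1+n v)) adm , gaps) , eq

  fork : ∀ l → InitLast l → Good v l → stats l ≡ s → ∃ (λ c → Tight v c × EndsIn c s l) ⊎ Member (suc v) s l
  fork .[] [] good eq = inj₂ (([] , []) , eq)
  fork .(l ∷ʳ c) (l ∷ʳ′ c) good eq with Good-∷ʳ⁻ l good
  ... | adm@(odd , le) , good′ with m≤n⇒m<n∨m≡n le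
  ... | inj₁ lt = inj₂ (Good-∷ʳ⁺ l (odd , lt) good′ , eq)
  ... | inj₂ e  = inj₁ (c , Admissible⇒Tight c adm e , l , refl , good′ , trans (sym (stats-∷ʳ l c)) eq)

EndsIn-disjoint : ∀ {c d s t} l → c ≢ d → EndsIn c s l → ¬ EndsIn d t l
EndsIn-disjoint l c≢d (l₁ , refl , _) (l₂ , eq , _) = c≢d (∷ʳ-injectiveʳ l₁ l₂ eq)

EndsIn-tight : ∀ {v c s t} l → Tight v c → EndsIn c s l → ¬ Member (suc v) t l
EndsIn-tight l tight (l′ , refl , _) (good , _) =
  let (_ , lt) , _ = Good-∷ʳ⁻ l′ good in <-irrefl (Tight⇒≡ tight) lt

EndsIn-count : ∀ c {s k} → HasCount (Member (4 + proj₁ c) s) k → HasCount (EndsIn c (stats [ c ] ⊞ s)) k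
EndsIn-count c H = HasCount-⇔
  (λ l → mk⇔ (λ { (l′ , eq , good , refl) → l′ , eq , good , refl })
             (λ { (l′ , eq , good , e) → l′ , eq , good , ⊞-cancelˡ (stats [ c ]) _ _ e }))
  (HasCount-image (_∷ʳ c) (∷ʳ-injectiveˡ _ _) H)
  where
  ⊞-cancelˡ : ∀ s t u → s ⊞ t ≡ s ⊞ u → t ≡ u
  ⊞-cancelˡ ((a₁ , a₂ , a₃ , a₄) , m) ((b₁ , b₂ , b₃ , b₄) , n) ((c₁ , c₂ , c₃ , c₄) , o) e
    with refl ← +-cancelˡ-≡ a₁ b₁ c₁ (cong (proj₁ ∘ proj₁) e)
       | refl ← +-cancelˡ-≡ a₂ b₂ c₂ (cong (proj₁ ∘ proj₂ ∘ proj₁) e)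
       | refl ← +-cancelˡ-≡ a₃ b₃ c₃ (cong (proj₁ ∘ proj₂ ∘ proj₂ ∘ proj₁) e)
       | refl ← +-cancelˡ-≡ a₄ b₄ c₄ (cong (proj₂ ∘ proj₂ ∘ proj₂ ∘ proj₁) e)
       | refl ← +-cancelˡ-≡ m n o (cong proj₂ e) = refl

-- `s` singles out the index that the part p raises. If that index is 0, or if n < p, no list ends
-- in p, in agreement with the zeros of `atPred` and `shift`. Counts are required only at remainders
-- n′ with n = p + n′, which gives recursive calls their bound.
EndsIn-count-shift : ∀ {p o e} (s : ℕ → ℕ × ℕ × ℕ × ℕ) (f : ℕ → Series) j n →
  stats [ (p , o) ] ≡ (e , p) →
  (∀ {m n′} → (s (suc m) , p + n′) ≡ (e , p) ⊞ (s m , n′)) →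
  (∀ t → (e , p) ⊞ t ≡ (s j , n) → (∃ λ m → j ≡ suc m) × p ≤ n) →
  (∀ m n′ → n ≡ p + n′ → HasCount (Member (4 + p) (s m , n′)) (f m n′)) →
  HasCount (EndsIn (p , o) (s j , n)) (atPred j (λ m → shift p (f m) n))
EndsIn-count-shift s f zero n eq add sub H =
  HasCount-∅ λ { l (l′ , _ , _ , e) → contradiction (proj₂ (proj₁ (sub (stats l′) (trans (cong (_⊞ stats l′) (sym eq)) e)))) λ () }
EndsIn-count-shift {p} {o} s f (suc j) n eq add sub H with p ≤? n
... | yes p≤n with n′ , refl ← m≤n⇒∃[o]m+o≡n p≤n =
  subst₂ (λ t k → HasCount (EndsIn (p , o) t) k)
    (trans (cong (_⊞ (s j , n′)) eq) (sym add)) (sym (shift-+ p (f j) n′))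
    (EndsIn-count (p , o) (H j n′ refl))
... | no p≰n = subst (HasCount (EndsIn (p , o) (s (suc j) , n))) (sym (shift-< (f j) (≰⇒> p≰n)))
  (HasCount-∅ λ { l (l′ , _ , _ , e) → p≰n (proj₂ (sub (stats l′) (trans (cong (_⊞ stats l′) (sym eq)) e))) })

module _ {p n₁ n₂ n₃ n₄ n : ℕ} (f : ℕ → Series) where

  EndsIn-count₁ : p % 4 ≡ 1 ⊎ p % 4 ≡ 3 →
    (∀ m n′ → n ≡ p + n′ → HasCount (Member (4 + p) ((m , n₂ , n₃ , n₄) , n′)) (f m n′)) →
    HasCount (EndsIn (p , false) ((n₁ , n₂ , n₃ , n₄) , n)) (atPred n₁ (λ m → shift p (f m) n))
  EndsIn-count₁ odd = EndsIn-count-shift (λ m → m , n₂ , n₃ , n₄) f n₁ n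
    (stat odd) refl (λ { _ refl → (_ , refl) , m≤m+n p _ })
    where
    stat : p % 4 ≡ 1 ⊎ p % 4 ≡ 3 → stats [ (p , false) ] ≡ ((1 , 0 , 0 , 0) , p)
    -- Replacing p % 2 by p % 4 % 2 lets the residue modulo 4 decide every filter.
    stat (inj₁ eq) rewrite sym (m∣n⇒o%n%m≡o%m 2 4 p (divides-refl 2)) | +-identityʳ p | eq = refl
    stat (inj₂ eq) rewrite sym (m∣n⇒o%n%m≡o%m 2 4 p (divides-refl 2)) | +-identityʳ p | eq = refl

  EndsIn-count₂ : p % 4 ≡ 1 ⊎ p % 4 ≡ 3 →
    (∀ m n′ → n ≡ p + n′ → HasCount (Member (4 + p) ((n₁ , m , n₃ , n₄) , n′)) (f m n′)) →
    HasCount (EndsIn (p , true) ((n₁ , n₂ , n₃ , n₄) , n)) (atPred n₂ (λ m → shift p (f m) n))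
  EndsIn-count₂ odd = EndsIn-count-shift (λ m → n₁ , m , n₃ , n₄) f n₂ n
    (stat odd) refl (λ { _ refl → (_ , refl) , m≤m+n p _ })
    where
    stat : p % 4 ≡ 1 ⊎ p % 4 ≡ 3 → stats [ (p , true) ] ≡ ((0 , 1 , 0 , 0) , p)
    stat (inj₁ eq) rewrite sym (m∣n⇒o%n%m≡o%m 2 4 p (divides-refl 2)) | +-identityʳ p | eq = refl
    stat (inj₂ eq) rewrite sym (m∣n⇒o%n%m≡o%m 2 4 p (divides-refl 2)) | +-identityʳ p | eq = refl

  EndsIn-count₃ : p % 4 ≡ 2 →
    (∀ m n′ → n ≡ p + n′ → HasCount (Member (4 + p) ((n₁ , n₂ , m , n₄) , n′)) (f m n′)) →
    HasCount (EndsIn (p , false) ((n₁ , n₂ , n₃ , n₄) , n)) (atPred n₃ (λ m → shift p (f m) n))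
  EndsIn-count₃ eq = EndsIn-count-shift (λ m → n₁ , n₂ , m , n₄) f n₃ n
    stat refl (λ { _ refl → (_ , refl) , m≤m+n p _ })
    where
    stat : stats [ (p , false) ] ≡ ((0 , 0 , 1 , 0) , p)
    stat rewrite sym (m∣n⇒o%n%m≡o%m 2 4 p (divides-refl 2)) | +-identityʳ p | eq = refl

  EndsIn-count₄ : p % 4 ≡ 0 →
    (∀ m n′ → n ≡ p + n′ → HasCount (Member (4 + p) ((n₁ , n₂ , n₃ , m) , n′)) (f m n′)) →
    HasCount (EndsIn (p , false) ((n₁ , n₂ , n₃ , n₄) , n)) (atPred n₄ (λ m → shift p (f m) n))
  EndsIn-count₄ eq = EndsIn-count-shift (λ m → n₁ , n₂ , n₃ , m) f n₄ n
    stat refl (λ { _ refl → (_ , refl) , m≤m+n p _ })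
    where
    stat : stats [ (p , false) ] ≡ ((0 , 0 , 0 , 1) , p)
    stat rewrite sym (m∣n⇒o%n%m≡o%m 2 4 p (divides-refl 2)) | +-identityʳ p | eq = refl

-- Coefficients of q^n with n < v

module _ {v b₁ b₂ b₃ b₄ : ℕ} (v≤b₁ : v ≤ b₁) (v≤b₂ : v ≤ b₂) (v≤b₃ : v ≤ b₃) (v≤b₄ : v ≤ b₄) where

  private
    Member⇒[] : ∀ {c n l} → n < v → Member v (c , n) l → l ≡ []
    Member⇒[] {l = []}    n<v _ = refl
    Member⇒[] {l = c ∷ l} n<v ((adm ∷ _ , _) , refl) =
      contradiction (≤-trans (Admissible⇒≤ c adm) (m≤m+n _ (size l))) (<⇒≱ n<v)

    count-none : ∀ {n₁ n₂ n₃ n₄ n} → n < v → (0 , 0 , 0 , 0) ≢ (n₁ , n₂ , n₃ , n₄) →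
      v ≤ b₁ * n₁ + b₂ * n₂ + b₃ * n₃ + b₄ * n₄ →
      HasCount (Member v ((n₁ , n₂ , n₃ , n₄) , n)) (Sterm′ b₁ b₂ b₃ b₄ n₁ n₂ n₃ n₄ n)
    count-none {n₁} {n₂} {n₃} {n₄} n<v s≢0 v≤ = subst (HasCount _)
      (sym (shift-< (invPochs n₁ n₂ n₃ n₄) (<-≤-trans n<v (m≤n⇒m≤n+o _ v≤))))
      (HasCount-∅ λ l mem → case-[] l (Member⇒[] n<v mem) mem)
      where
      case-[] : ∀ l → l ≡ [] → ¬ Member v _ l
      case-[] .[] refl (_ , eq) = s≢0 (cong proj₁ eq)

    invPochs-0 : invPochs 0 0 0 0 ≗ one
    invPochs-0 n = trans (⊛-identityʳ (one ⊛ one ⊛ one) n)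
                     (trans (⊛-identityʳ (one ⊛ one) n) (⊛-identityʳ one n))

    exponent-0 : exponent b₁ b₂ b₃ b₄ 0 0 0 0 ≡ 0
    exponent-0 rewrite *-zeroʳ b₁ | *-zeroʳ b₂ | *-zeroʳ b₃ | *-zeroʳ b₄ = refl

    Sterm′-0 : Sterm′ b₁ b₂ b₃ b₄ 0 0 0 0 ≗ one
    Sterm′-0 n = trans (cong (λ e → shift e (invPochs 0 0 0 0) n) exponent-0) (invPochs-0 n)

  -- Below size v the only member is the empty list. On the series side a nonzero index makes the
  -- exponent of q at least some bᵢ ≥ v, and the summand at index 0 is 1.
  count-base : ∀ n₁ n₂ n₃ n₄ n → n < v →
    HasCount (Member v ((n₁ , n₂ , n₃ , n₄) , n)) (Sterm′ b₁ b₂ b₃ b₄ n₁ n₂ n₃ n₄ n)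
  count-base zero zero zero zero zero n<v = subst (HasCount _) (sym (Sterm′-0 0))
    (HasCount-singleton [] λ l → mk⇔ (λ { refl → ([] , []) , refl }) (Member⇒[] n<v))
  count-base zero zero zero zero (suc n) n<v = subst (HasCount _) (sym (Sterm′-0 (suc n)))
    (HasCount-∅ λ { l mem@(_ , eq) →
      contradiction (trans (sym (cong proj₂ eq)) (cong size (Member⇒[] n<v mem))) λ () })
  count-base (suc n₁) n₂ n₃ n₄ n n<v = count-none n<v (λ ())
    (m≤n⇒m≤n+o _ (m≤n⇒m≤n+o _ (m≤n⇒m≤n+o _ (≤-trans v≤b₁ (m≤m*n b₁ (suc n₁))))))
  count-base zero (suc n₂) n₃ n₄ n n<v = count-none n<v (λ ())
    (m≤n⇒m≤n+o _ (m≤n⇒m≤n+o _ (m≤n⇒m≤o+n (b₁ * 0) (≤-trans v≤b₂ (m≤m*n b₂ (suc n₂))))))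
  count-base zero zero (suc n₃) n₄ n n<v = count-none n<v (λ ())
    (m≤n⇒m≤n+o _ (m≤n⇒m≤o+n (b₁ * 0 + b₂ * 0) (≤-trans v≤b₃ (m≤m*n b₃ (suc n₃)))))
  count-base zero zero zero (suc n₄) n n<v = count-none n<v (λ ())
    (m≤n⇒m≤o+n (b₁ * 0 + b₂ * 0 + b₃ * 0) (≤-trans v≤b₄ (m≤m*n b₄ (suc n₄))))

-- The recurrences, by residue of v modulo 4

Member-count₁ : ∀ {v s j k} c → Tight v c → (∀ {c′} → Tight v c′ → c′ ≡ c) →
  HasCount (EndsIn c s) j → HasCount (Member (suc v) s) k → HasCount (Member v s) (j + k)
Member-count₁ {v} {s} c tight unique H K = HasCount-⇔
  (λ l → mk⇔
    (to (Member-step v s l) ∘ map-⊎ (λ e → c , tight , e) id)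
    (map-⊎ (λ { (c′ , t , e) → subst (λ d → EndsIn d s l) (unique t) e }) id ∘ from (Member-step v s l)))
  (HasCount-⊎ (λ l → EndsIn-tight l tight) H K)

Member-count₂ : ∀ {v s i j k} c d → c ≢ d → Tight v c → Tight v d → (∀ {c′} → Tight v c′ → c′ ≡ c ⊎ c′ ≡ d) →
  HasCount (EndsIn c s) i → HasCount (EndsIn d s) j → HasCount (Member (suc v) s) k →
  HasCount (Member v s) (i + (j + k))
Member-count₂ {v} {s} c d c≢d tight-c tight-d unique H J K = HasCount-⇔
  (λ l → mk⇔ (to (Member-step v s l) ∘ join l) (fork l ∘ from (Member-step v s l)))
  (HasCount-⊎ (λ { l e (inj₁ e′) → EndsIn-disjoint l c≢d e e′ ; l e (inj₂ m) → EndsIn-tight l tight-c e m })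
    H (HasCount-⊎ (λ l → EndsIn-tight l tight-d) J K))
  where
  join : ∀ l → EndsIn c s l ⊎ EndsIn d s l ⊎ Member (suc v) s l → (∃ λ c → Tight v c × EndsIn c s l) ⊎ Member (suc v) s l
  join l (inj₁ e)        = inj₁ (c , tight-c , e)
  join l (inj₂ (inj₁ e)) = inj₁ (d , tight-d , e)
  join l (inj₂ (inj₂ m)) = inj₂ m
  fork : ∀ l → (∃ λ c → Tight v c × EndsIn c s l) ⊎ Member (suc v) s l → EndsIn c s l ⊎ EndsIn d s l ⊎ Member (suc v) s l
  fork l (inj₂ m) = inj₂ (inj₂ m)
  fork l (inj₁ (c′ , t , e)) with unique t
  ... | inj₁ refl = inj₁ e
  ... | inj₂ refl = inj₂ (inj₁ e)

mod4 : ∀ r k → (r + k * 4) % 4 ≡ r % 4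
mod4 r k = [m+kn]%n≡m%n r k 4

mod2 : ∀ r k → (r + k * 4) % 2 ≡ r % 4 % 2
mod2 r k = trans (sym (m∣n⇒o%n%m≡o%m 2 4 (r + k * 4) (divides-refl 2))) (cong (_% 2) (mod4 r k))

module _ (k : ℕ) where

  -- An overlined v + 1 requires v even, a multiple of 4 at v + 1 requires v ≡ 3, and v itself
  -- requires v not divisible by 4. This leaves one tight part for v ≡ 0, 1 and two for v ≡ 2, 3.
  Tight₀ : ∀ {c} → Tight (k * 4) c → c ≡ (1 + k * 4 , true)
  Tight₀ (overlined _)      = refl
  Tight₀ (multipleOf4 d)    = contradiction (trans (sym (mod4 1 k)) d) λ ()
  Tight₀ (notMultipleOf4 d) = contradiction (mod4 0 k) d

  Tight₁ : ∀ {c} → Tight (1 + k * 4) c → c ≡ (1 + k * 4 , false)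
  Tight₁ (overlined d)      = contradiction (trans (sym (mod2 2 k)) d) λ ()
  Tight₁ (multipleOf4 d)    = contradiction (trans (sym (mod4 2 k)) d) λ ()
  Tight₁ (notMultipleOf4 _) = refl

  Tight₂ : ∀ {c} → Tight (2 + k * 4) c → c ≡ (2 + k * 4 , false) ⊎ c ≡ (3 + k * 4 , true)
  Tight₂ (overlined _)      = inj₂ refl
  Tight₂ (multipleOf4 d)    = contradiction (trans (sym (mod4 3 k)) d) λ ()
  Tight₂ (notMultipleOf4 _) = inj₁ refl

  Tight₃ : ∀ {c} → Tight (3 + k * 4) c → c ≡ (3 + k * 4 , false) ⊎ c ≡ (4 + k * 4 , false)
  Tight₃ (overlined d)      = contradiction (trans (sym (mod2 4 k)) d) λ ()
  Tight₃ (multipleOf4 _)    = inj₂ refl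
  Tight₃ (notMultipleOf4 _) = inj₁ refl

  notMult : ∀ r → r % 4 ≢ 0 → Tight (r + k * 4) (r + k * 4 , false)
  notMult r r≢0 = notMultipleOf4 λ d → r≢0 (trans (sym (mod4 r k)) d)

stay : ∀ f {v n} → n < suc f + v → n < f + suc v
stay f {v} n< = <-≤-trans n< (≤-reflexive (sym (+-suc f v)))

-- Removing a part p ≥ v lowers n and replaces v by 4 + p, so the bound survives spending one unit
-- of fuel.
descend : ∀ f {v p n n′} → v ≤ p → n ≡ p + n′ → n < suc f + v → n′ < f + (4 + p)
descend f {v} {p} {_} {n′} v≤p refl n< = begin-strict
  n′          ≤⟨ m≤n+m n′ p ⟩
  p + n′      <⟨ n< ⟩
  suc f + v   ≡⟨ +-suc f v ⟨
  f + suc v   ≤⟨ +-monoʳ-≤ f (s≤s (≤-trans v≤p (m≤n+m p 3))) ⟩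
  f + (4 + p) ∎
  where open ≤-Reasoning

MemberCount-below : (f v b₁ b₂ b₃ b₄ : ℕ) → Set
MemberCount-below f v b₁ b₂ b₃ b₄ = ∀ n₁ n₂ n₃ n₄ n → n < f + v →
  HasCount (Member v ((n₁ , n₂ , n₃ , n₄) , n)) (Sterm′ b₁ b₂ b₃ b₄ n₁ n₂ n₃ n₄ n)

-- The fuel f bounds how much further v can grow before it exceeds n.
mutual

  count₀ : ∀ f k → let K = k * 4 in MemberCount-below f K (1 + K) (1 + K) (2 + K) (4 + K)
  count₀ zero k = count-base (m≤n+m _ 1) (m≤n+m _ 1) (m≤n+m _ 2) (m≤n+m _ 4)
  count₀ (suc f) k n₁ n₂ n₃ n₄ n n< = subst (HasCount _)
    -- Lowering n₂ gives (5,7,6,8) + K, the exponents of `count₁` at k + 1; raising b₂ by 2 gives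
    -- those of `count₁` at k.
    (sym (Sterm′-split₂ (1 + K) (1 + K) (2 + K) (4 + K) n₁ n₂ n₃ n₄ n))
    (Member-count₁ (1 + K , true) (overlined (mod2 1 k)) (Tight₀ k)
      (EndsIn-count₂ (λ m → Sterm′ (5 + K) (7 + K) (6 + K) (8 + K) n₁ m n₃ n₄) (inj₁ (mod4 1 k))
        (λ m n′ eq → count₁ f (suc k) n₁ m n₃ n₄ n′ (descend f (m≤n+m K 1) eq n<)))
      (count₁ f k n₁ n₂ n₃ n₄ n (stay f n<)))
    where K = k * 4

  count₁ : ∀ f k → let K = k * 4 in MemberCount-below f (1 + K) (1 + K) (3 + K) (2 + K) (4 + K)
  count₁ zero k = count-base ≤-refl (m≤n+m _ 2) (m≤n+m _ 1) (m≤n+m _ 3)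
  count₁ (suc f) k n₁ n₂ n₃ n₄ n n< = subst (HasCount _)
    (sym (Sterm′-split₁ (1 + K) (3 + K) (2 + K) (4 + K) n₁ n₂ n₃ n₄ n))
    (Member-count₁ (1 + K , false) (notMult k 1 λ ()) (Tight₁ k)
      (EndsIn-count₁ (λ m → Sterm′ (5 + K) (7 + K) (6 + K) (8 + K) m n₂ n₃ n₄) (inj₁ (mod4 1 k))
        (λ m n′ eq → count₁ f (suc k) m n₂ n₃ n₄ n′ (descend f ≤-refl eq n<)))
      (count₂ f k n₁ n₂ n₃ n₄ n (stay f n<)))
    where K = k * 4

  count₂ : ∀ f k → let K = k * 4 in MemberCount-below f (2 + K) (3 + K) (3 + K) (2 + K) (4 + K)
  count₂ zero k = count-base (m≤n+m _ 1) (m≤n+m _ 1) ≤-refl (m≤n+m _ 2)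
  count₂ (suc f) k n₁ n₂ n₃ n₄ n n< = subst (HasCount _)
    -- Two tight parts call for two splittings. The second acts on (3,3,6,4) + K, so its lowered
    -- term is (7,9,10,8) + K, the exponents of `count₃` at k + 1.
    (sym (trans (Sterm′-split₃ (3 + K) (3 + K) (2 + K) (4 + K) n₁ n₂ n₃ n₄ n)
      (cong₂ _+_ refl (Sterm′-split₂ (3 + K) (3 + K) (6 + K) (4 + K) n₁ n₂ n₃ n₄ n))))
    (Member-count₂ (2 + K , false) (3 + K , true) (λ ()) (notMult k 2 λ ()) (overlined (mod2 3 k)) (Tight₂ k)
      (EndsIn-count₃ (λ m → Sterm′ (7 + K) (7 + K) (6 + K) (8 + K) n₁ n₂ m n₄) (mod4 2 k)
        (λ m n′ eq → count₂ f (suc k) n₁ n₂ m n₄ n′ (descend f ≤-refl eq n<)))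
      (EndsIn-count₂ (λ m → Sterm′ (7 + K) (9 + K) (10 + K) (8 + K) n₁ m n₃ n₄) (inj₂ (mod4 3 k))
        (λ m n′ eq → count₃ f (suc k) n₁ m n₃ n₄ n′ (descend f (m≤n+m _ 1) eq n<)))
      (count₃ f k n₁ n₂ n₃ n₄ n (stay f n<)))
    where K = k * 4

  count₃ : ∀ f k → let K = k * 4 in MemberCount-below f (3 + K) (3 + K) (5 + K) (6 + K) (4 + K)
  count₃ zero k = count-base ≤-refl (m≤n+m _ 2) (m≤n+m _ 3) (m≤n+m _ 1)
  count₃ (suc f) k n₁ n₂ n₃ n₄ n n< = subst (HasCount _)
    -- Splitting n₁ and then n₄ ends at (5,5,6,8) + K, which is `count₀` at k + 1 and closes the
    -- cycle. Removing the part 4 + K leads to `count₀` at k + 2.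
    (sym (trans (Sterm′-split₁ (3 + K) (5 + K) (6 + K) (4 + K) n₁ n₂ n₃ n₄ n)
      (cong₂ _+_ refl (Sterm′-split₄ (5 + K) (5 + K) (6 + K) (4 + K) n₁ n₂ n₃ n₄ n))))
    (Member-count₂ (3 + K , false) (4 + K , false) (λ eq → 1+n≢n (sym (cong proj₁ eq))) (notMult k 3 λ ()) (multipleOf4 (mod4 4 k)) (Tight₃ k)
      (EndsIn-count₁ (λ m → Sterm′ (7 + K) (9 + K) (10 + K) (8 + K) m n₂ n₃ n₄) (inj₂ (mod4 3 k))
        (λ m n′ eq → count₃ f (suc k) m n₂ n₃ n₄ n′ (descend f ≤-refl eq n<)))
      (EndsIn-count₄ (λ m → Sterm′ (9 + K) (9 + K) (10 + K) (12 + K) n₁ n₂ n₃ m) (mod4 4 k)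
        (λ m n′ eq → count₀ f (suc (suc k)) n₁ n₂ n₃ m n′ (descend f (m≤n+m _ 1) eq n<)))
      (count₀ f (suc k) n₁ n₂ n₃ n₄ n (stay f n<)))
    where K = k * 4

-- From summation indices to coefficients of S

-- The four classes are disjoint because overlined parts are odd; an even overlined part would be
-- counted twice.
nparts-decompose : ∀ l → All (λ c → proj₂ c ≡ true → proj₁ c % 2 ≡ 1) l →
  nparts l ≡ nplain l + noverlined l + nparts-mod4 2 l + nparts-mod4 0 l
nparts-decompose []      []           = refl
nparts-decompose (c ∷ l) (odd ∷ odds) = begin
  1 + nparts l ≡⟨ cong₂ _+_ (sym (single c odd)) (nparts-decompose l odds) ⟩
  _            ≡⟨ shuffle (nplain [ c ]) (noverlined [ c ]) (nparts-mod4 2 [ c ]) (nparts-mod4 0 [ c ]) _ _ _ _ ⟩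
  _            ≡⟨ cong₂ _+_ (cong₂ _+_ (cong₂ _+_ (filtered isPlain?) (filtered (λ x → proj₂ x B.≟ true)))
                     (filtered (λ x → proj₁ x % 4 ≟ 2))) (filtered (λ x → proj₁ x % 4 ≟ 0)) ⟨
  _            ∎
  where
  open ≡-Reasoning
  filtered : ∀ {P : Part → Set} (P? : ∀ x → Dec (P x)) →
             length (filter P? (c ∷ l)) ≡ length (filter P? [ c ]) + length (filter P? l)
  filtered P? = length-filter-++ P? [ c ] l
  shuffle : ∀ a b c d a′ b′ c′ d′ →
    a + b + c + d + (a′ + b′ + c′ + d′) ≡ a + a′ + (b + b′) + (c + c′) + (d + d′)
  shuffle = solve-∀
  single : ∀ c → (proj₂ c ≡ true → proj₁ c % 2 ≡ 1) →
           nplain [ c ] + noverlined [ c ] + nparts-mod4 2 [ c ] + nparts-mod4 0 [ c ] ≡ 1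
  single (p , o) odd rewrite sym (m∣n⇒o%n%m≡o%m 2 4 p (divides-refl 2)) with p % 4 | m%n<n p 4
  single (p , true)  odd | 0 | _ = contradiction (odd refl) λ ()
  single (p , true)  odd | 1 | _ = refl
  single (p , true)  odd | 2 | _ = contradiction (odd refl) λ ()
  single (p , true)  odd | 3 | _ = refl
  single (p , false) odd | 0 | _ = refl
  single (p , false) odd | 1 | _ = refl
  single (p , false) odd | 2 | _ = refl
  single (p , false) odd | 3 | _ = refl
  single (p , o) odd | suc (suc (suc (suc _))) | s≤s (s≤s (s≤s (s≤s ())))

sum-zero : ∀ g n → (∀ i → g i ≡ 0) → sum (applyUpTo g n) ≡ 0
sum-zero g zero    g≡0 = refl
sum-zero g (suc n) g≡0 = cong₂ _+_ (g≡0 0) (sum-zero (g ∘ suc) n (g≡0 ∘ suc))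

sum-single : ∀ g {i n} → i < n → (∀ j → j ≢ i → g j ≡ 0) → sum (applyUpTo g n) ≡ g i
sum-single g {zero}  {suc n} _ g≡0 =
  trans (cong (g 0 +_) (sum-zero (g ∘ suc) n (λ j → g≡0 (suc j) λ ()))) (+-identityʳ _)
sum-single g {suc i} {suc n} (s≤s i<n) g≡0 =
  cong₂ _+_ (g≡0 0 λ ()) (sum-single (g ∘ suc) i<n (λ j j≢i → g≡0 (suc j) (j≢i ∘ suc-injective)))

module _ (b₁ b₂ b₃ b₄ k₁ k₂ m n : ℕ) where

  private
    summand : ℕ → ℕ → ℕ
    summand a i = if does (i + m + k₁ + k₂ ≟ a) then Sterm b₁ b₂ b₃ b₄ i m k₁ k₂ n else 0

    summand-≢ : ∀ a i → i + m + k₁ + k₂ ≢ a → summand a i ≡ 0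
    summand-≢ a i neq rewrite dec-false (i + m + k₁ + k₂ ≟ a) neq = refl

    total-injective : ∀ i j → i + m + k₁ + k₂ ≡ j + m + k₁ + k₂ → i ≡ j
    total-injective i j = +-cancelʳ-≡ m i j ∘ +-cancelʳ-≡ k₁ (i + m) (j + m) ∘ +-cancelʳ-≡ k₂ (i + m + k₁) (j + m + k₁)

  -- Once the other indices are fixed, the total determines n₁, so a single summand survives; n₁ ≤ a
  -- keeps it within the range of summation.
  Scoeff-total : ∀ n₁ → Scoeff b₁ b₂ b₃ b₄ (n₁ + m + k₁ + k₂) k₁ k₂ m n ≡ Sterm b₁ b₂ b₃ b₄ n₁ m k₁ k₂ n
  Scoeff-total n₁ = begin
    Scoeff b₁ b₂ b₃ b₄ a k₁ k₂ m n           ≡⟨ cong sum (map-upTo (summand a) (suc a)) ⟩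
    sum (applyUpTo (summand a) (suc a))      ≡⟨ sum-single (summand a) (s≤s (≤-trans (m≤m+n n₁ m) (≤-trans (m≤m+n _ k₁) (m≤m+n _ k₂))))
                                                 (λ j j≢n₁ → summand-≢ a j (j≢n₁ ∘ total-injective j n₁)) ⟩
    summand a n₁                             ≡⟨ cong (λ d → if d then Sterm b₁ b₂ b₃ b₄ n₁ m k₁ k₂ n else 0) (dec-true (a ≟ a) refl) ⟩
    Sterm b₁ b₂ b₃ b₄ n₁ m k₁ k₂ n           ∎
    where
    open ≡-Reasoning
    a = n₁ + m + k₁ + k₂

  Scoeff-none : ∀ a → (∀ i → i + m + k₁ + k₂ ≢ a) → Scoeff b₁ b₂ b₃ b₄ a k₁ k₂ m n ≡ 0
  Scoeff-none a neq = trans (cong sum (map-upTo (summand a) (suc a))) (sum-zero (summand a) (suc a) (λ i → summand-≢ a i (neq i)))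

total? : ∀ a m k₁ k₂ → Dec (∃ λ n₁ → n₁ + m + k₁ + k₂ ≡ a)
total? a m k₁ k₂ with m + k₁ + k₂ ≤? a
... | yes le = yes (a ∸ (m + k₁ + k₂) , trans (reassoc (a ∸ (m + k₁ + k₂)) m k₁ k₂) (m∸n+n≡m le))
  where
  reassoc : ∀ i m k₁ k₂ → i + m + k₁ + k₂ ≡ i + (m + k₁ + k₂)
  reassoc = solve-∀
... | no nle = no λ { (i , refl) → nle (+-monoˡ-≤ k₂ (+-monoˡ-≤ k₁ (m≤n+m m i))) }

-- The avoidance classes as bounds v = 0, 1, 2, 3

AdmissibleAvoids : ℕ → List Part → Set
AdmissibleAvoids v S =
  ∀ c → Admissible v c ⇔ (1 ≤ proj₁ c × (proj₂ c ≡ true → proj₁ c % 2 ≡ 1) × c ∉ S)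

-- The ordering condition of overpartitions comes for free: gaps are positive, so the values
-- strictly decrease.
Good⇔InA-avoid : ∀ {S v} → AdmissibleAvoids v S → ∀ l → Good v l ⇔ InA-avoid S l
Good⇔InA-avoid adm⇔ l = mk⇔
  (λ { (adm , gaps) →
    ((All.map (proj₁ ∘ to (adm⇔ _)) adm ,
      AllPairs⇒Linked (AllPairs.map (λ {c} {d} → consec {c} {d}) gaps)) ,
     All.map proj₁ adm , gaps) ,
    All.map (proj₂ ∘ proj₂ ∘ to (adm⇔ _)) adm })
  (λ { (((pos , _) , odd , gaps) , avoid) →
    All.map (from (adm⇔ _)) (All.zip (pos , All.zip (odd , avoid))) , gaps })
  where
  consec : ∀ {c d} → GapOK c d → ConsecOK c d
  consec {c} {q , _} le = inj₁ (≤-trans (+-monoˡ-≤ q (≤-trans (s≤s z≤n) (4≤gap c))) (≤-trans (≤-reflexive (+-comm (gap c) q)) le))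

MemberCount : (v b₁ b₂ b₃ b₄ : ℕ) → Set
MemberCount v b₁ b₂ b₃ b₄ = ∀ n₁ n₂ n₃ n₄ n →
  HasCount (Member v ((n₁ , n₂ , n₃ , n₄) , n)) (Sterm′ b₁ b₂ b₃ b₄ n₁ n₂ n₃ n₄ n)

-- The exponent a of x is traded for n₁ by `nparts-decompose`. If no n₁ gives the total a, the
-- coefficient is 0 and no overpartition has these statistics.
GFIdentity-from : ∀ {S v} b₁ b₂ b₃ b₄ → (∀ l → Good v l ⇔ InA-avoid S l) →
  MemberCount v b₁ b₂ b₃ b₄ → GFIdentity S b₁ b₂ b₃ b₄
GFIdentity-from b₁ b₂ b₃ b₄ good⇔ count a k₁ k₂ m n with total? a m k₁ k₂
... | yes (n₁ , refl) = subst (HasCount _)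
  (sym (trans (Scoeff-total b₁ b₂ b₃ b₄ k₁ k₂ m n n₁) (Sterm≗Sterm′ b₁ b₂ b₃ b₄ n₁ m k₁ k₂ n)))
  (HasCount-⇔ (λ l → mk⇔
    (λ { (good , refl) → to (good⇔ l) good , nparts-decompose l (All.map proj₁ (proj₁ good)) , refl , refl , refl , refl })
    (λ { (inA , len , refl , refl , refl , refl) → let good = from (good⇔ l) inA in
      good , cong (λ i → (i , m , k₁ , k₂) , n)
        (+-cancelʳ-≡ m _ n₁ (+-cancelʳ-≡ k₁ _ (n₁ + m) (+-cancelʳ-≡ k₂ _ (n₁ + m + k₁)
          (trans (sym (nparts-decompose l (All.map proj₁ (proj₁ good)))) len)))) }))
    (count n₁ m k₁ k₂ n))
... | no none = subst (HasCount _) (sym (Scoeff-none b₁ b₂ b₃ b₄ k₁ k₂ m n a λ i eq → none (i , eq)))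
  (HasCount-∅ λ { l (((_ , odd , _) , _) , len , refl , refl , refl , refl) →
    none (nplain l , trans (sym (nparts-decompose l odd)) len) })

-- A gap is at most 5 = 4 + 1, which admits every positive value. The value 0 has gap 5 > 4,
-- overlined or not, since 4 divides 0.
admissible₀ : AdmissibleAvoids 0 []
admissible₀ c = mk⇔ (λ adm → positive c adm , proj₁ adm , λ ())
  (λ { (1≤p , odd , _) → odd , ≤-trans (gap≤5 c) (+-monoʳ-≤ 4 1≤p) })
  where
  gap≤5 : ∀ c → gap c ≤ 5
  gap≤5 (p , true)  = ≤-refl
  gap≤5 (p , false) with p % 4
  ... | zero  = ≤-refl
  ... | suc _ = n≤1+n 4
  positive : ∀ c → Admissible 0 c → 1 ≤ proj₁ c
  positive (suc p , _)     _       = s≤s z≤n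
  positive (zero , true)  (_ , le) = contradiction le (<⇒≱ ≤-refl)
  positive (zero , false) (_ , le) = contradiction le (<⇒≱ ≤-refl)

-- Raising v by one forbids exactly the parts tight at v, so the forbidden sets grow by the parts
-- found in `Tight₀`, `Tight₁` and `Tight₂` at k = 0.
AdmissibleAvoids-suc : ∀ {v S S′} → (∀ {c} → c ∈ S′ → c ∈ S ⊎ Tight v c) →
  (∀ {c} → c ∈ S ⊎ Tight v c → c ∈ S′) → AdmissibleAvoids v S → AdmissibleAvoids (suc v) S′
AdmissibleAvoids-suc {v} S′⊆ S′⊇ adm⇔ c = mk⇔
  (λ { adm@(_ , lt) → let pos , odd , c∉S = to (adm⇔ c) (Admissible-anti (n≤1+n v) adm) in
    pos , odd , λ c∈S′ → [ c∉S , (λ t → <-irrefl (Tight⇒≡ t) lt) ]′ (S′⊆ c∈S′) })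
  (λ { (pos , odd , c∉S′) → let adm = from (adm⇔ c) (pos , odd , λ c∈S → c∉S′ (S′⊇ (inj₁ c∈S))) in
    odd , ≤∧≢⇒< (proj₂ adm) (λ eq → c∉S′ (S′⊇ (inj₂ (Admissible⇒Tight c adm eq)))) })

admissible₁ : AdmissibleAvoids 1 ((1 , true) ∷ [])
admissible₁ = AdmissibleAvoids-suc (λ { (here refl) → inj₂ (overlined refl) ; (there ()) })
  (λ { (inj₁ ()) ; (inj₂ t) → here (Tight₀ 0 t) }) admissible₀

admissible₂ : AdmissibleAvoids 2 ((1 , false) ∷ (1 , true) ∷ [])
admissible₂ = AdmissibleAvoids-suc
  (λ { (here refl) → inj₂ (notMultipleOf4 λ ()) ; (there c∈S) → inj₁ c∈S })
  (λ { (inj₁ c∈S) → there c∈S ; (inj₂ t) → here (Tight₁ 0 t) }) admissible₁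

admissible₃ : AdmissibleAvoids 3 ((1 , false) ∷ (1 , true) ∷ (2 , false) ∷ (3 , true) ∷ [])
admissible₃ = AdmissibleAvoids-suc
  (λ { (here refl)                         → inj₁ (here refl)
     ; (there (here refl))                 → inj₁ (there (here refl))
     ; (there (there (here refl)))         → inj₂ (notMultipleOf4 λ ())
     ; (there (there (there (here refl)))) → inj₂ (overlined refl) })
  (λ { (inj₁ (here refl))         → here refl
     ; (inj₁ (there (here refl))) → there (here refl)
     ; (inj₂ t)                   → there (there (tight (Tight₂ 0 t))) })
  admissible₂
  where
  tight : ∀ {c : Part} → c ≡ (2 , false) ⊎ c ≡ (3 , true) → c ∈ (2 , false) ∷ (3 , true) ∷ []
  tight (inj₁ eq) = here eq
  tight (inj₂ eq) = there (here eq)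

theorem5p1 : GFIdentity [] 1 1 2 4
    × GFIdentity ((1 , true) ∷ []) 1 3 2 4
    × GFIdentity ((1 , false) ∷ (1 , true) ∷ []) 3 3 2 4
    × GFIdentity ((1 , false) ∷ (1 , true) ∷ (2 , false) ∷ (3 , true) ∷ []) 3 5 6 4
theorem5p1 =
    GFIdentity-from 1 1 2 4 (Good⇔InA-avoid admissible₀)
      -- Fuel `suc n` suffices because n < suc n + v.
      (λ n₁ n₂ n₃ n₄ n → count₀ (suc n) 0 n₁ n₂ n₃ n₄ n (m≤m+n (suc n) 0))
  , GFIdentity-from 1 3 2 4 (Good⇔InA-avoid admissible₁)
      (λ n₁ n₂ n₃ n₄ n → count₁ (suc n) 0 n₁ n₂ n₃ n₄ n (m≤m+n (suc n) 1))
  , GFIdentity-from 3 3 2 4 (Good⇔InA-avoid admissible₂)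
      (λ n₁ n₂ n₃ n₄ n → count₂ (suc n) 0 n₁ n₂ n₃ n₄ n (m≤m+n (suc n) 2))
  , GFIdentity-from 3 5 6 4 (Good⇔InA-avoid admissible₃)
      (λ n₁ n₂ n₃ n₄ n → count₃ (suc n) 0 n₁ n₂ n₃ n₄ n (m≤m+n (suc n) 3))
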